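{- The pointwise continuity of type 2 functionals, i.e. the sentence $$\forall\Phi^{(\mathbb N\to\mathbb N)\to\mathbb N}\,\forall f^{\mathbb N\to\mathbb N}\,\exists N^{\mathbb N}\,\forall g^{\mathbb N\to\mathbb N}\,\bigl(\forall n\le N\,(fn=_{\mathbb N}gn)\to\Phi f=_{\mathbb N}\Phi g\bigr)$$ of the language of $\mathrm{HA}^\omega$, is $\mathcal I^{\mathrm{cp}}$-interpretable.
   Context: $\mathrm{HA}^\omega$ is Heyting arithmetic in all finite types generated by $\sigma\to\tau$ from ground types $\mathbb N$ and $\mathbb B$ (Booleans), with combinators, $0$, successor, recursors, Boolean constants and conditionals; its only relation symbols are logical equalities $\equiv_\sigma$ at each type ($=_{\mathbb N}$ is $\equiv_{\mathbb N}$). $x\le y$ abbreviates a quantifier-free equation of type $\mathbb N$ (e.g. $x\dot-y\equiv_{\mathbb N}0$) and $\forall n\le N(\dots)$ abbreviates $\forall n^{\mathbb N}(n\le N\to\dots)$. Formulas use $\bot,\wedge,\to,\forall x^\sigma,\exists x^\sigma$. Target language: the language of $\mathrm{HA}^\omega$ with the extra type constructor $\sigma\mapsto\sigma^*$ (non-empty finite subsets) and constants for singleton, union, indexed union $\bigcup_{w\in t}qw$, membership, combinators, conditionals and recursors for all these types, and $\mathrm m:\mathbb N^*\to\mathbb N$ (maximum). $\mathcal S^\omega_*$ is the structure with $\mathcal S_{\mathbb N}=\mathbb N$, $\mathcal S_{\mathbb B}=\{0,1\}$, $\mathcal S_{\rho\to\sigma}$ all functions from $\mathcal S_\rho$ to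 $\mathcal S_\sigma$, $\mathcal S_{\sigma^*}$ all non-empty finite subsets of $\mathcal S_\sigma$. The target theory $T$ is the set of sentences true in $\mathcal S^\omega_*$. Witnessing types are the types of the target language; witnessing terms are its terms. $\mathcal L^{\mathcal I}$ adds to the language of $\mathrm{HA}^\omega$ a unary predicate $\mathcal I_\sigma(x^\sigma)$ for each type. Boldface letters are (possibly empty) tuples, $\forall\boldsymbol b\in\boldsymbol B$ is componentwise. $\mathcal I^{\mathrm{cp}}$ (canonical upon precise) is given by: $\langle\mathcal I_{\mathbb N}(x)\rangle^n$ is $x=n$; $\langle\mathcal I_{\mathbb B}(i)\rangle^j$ is $i=j$; and $\langle\mathcal I_{\rho\to\sigma}(h)\rangle^{\boldsymbol f,\boldsymbol g}_{\boldsymbol a,\boldsymbol d}:\equiv\forall x^\rho(\forall\boldsymbol b\in\boldsymbol g\boldsymbol a\boldsymbol d\,\langle\mathcal I_\rho(x)\rangle^{\boldsymbol a}_{\boldsymbol b}\to\langle\mathcal I_\sigma(hx)\rangle^{\boldsymbol f\boldsymbol a}_{\boldsymbol d})$. In particular, $\langle\mathcal I_{\mathbb N\to\mathbb N}(f)\rangle^g_k$ is $fk=gk$ and $\langle\mathcal I_{(\mathbb N\to\mathbb N)\to\mathbb N}(\Phi)\rangle^{\Psi,\mu}_h$ is $\forall f(\forall k\in\mu h(fk=hk)\to\Phi f=\Psi h)$, with $\mu:(\mathbb N\to\mathbb N)\to\mathbb N^*$, $\Psi:(\mathbb N\to\mathbb N)\to\mathbb N$. $\mathcal U$-interpretation of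 formulas of $\mathcal L^{\mathcal I}$: $\langle x\equiv_\sigma y\rangle$ is $x=y$; $\langle\bot\rangle:\equiv\bot$; $\langle A\wedge B\rangle^{\boldsymbol a,\boldsymbol c}_{\boldsymbol b,\boldsymbol d}:\equiv\langle A\rangle^{\boldsymbol a}_{\boldsymbol b}\wedge\langle B\rangle^{\boldsymbol c}_{\boldsymbol d}$; $\langle A\to B\rangle^{\boldsymbol f,\boldsymbol g}_{\boldsymbol a,\boldsymbol d}:\equiv\forall\boldsymbol b\in\boldsymbol g\boldsymbol a\boldsymbol d\,\langle A\rangle^{\boldsymbol a}_{\boldsymbol b}\to\langle B\rangle^{\boldsymbol f\boldsymbol a}_{\boldsymbol d}$; $\langle\forall xA\rangle^{\boldsymbol a}_{\boldsymbol b}:\equiv\forall x\langle A\rangle^{\boldsymbol a}_{\boldsymbol b}$; $\langle\exists xA\rangle^{\boldsymbol a}_{\boldsymbol B}:\equiv\exists x\forall\boldsymbol b\in\boldsymbol B\langle A\rangle^{\boldsymbol a}_{\boldsymbol b}$. $A$ is $\mathcal U$-interpretable if there are closed witnessing terms $\boldsymbol t$ with $T\vdash\forall\boldsymbol b\langle A\rangle^{\boldsymbol t}_{\boldsymbol b}$. $A^{\mathcal I}$ replaces $\forall x^\sigma(\dots)$ by $\forall x^\sigma(\mathcal I_\sigma(x)\to\dots)$ and $\exists x^\sigma(\dots)$ by $\exists x^\sigma(\mathcal I_\sigma(x)\wedge\dots)$. A sentence $A$ of $\mathrm{HA}^\omega$ is $\mathcal I^{\mathrm{cp}}$-interpretable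 if $A^{\mathcal I}$ is $\mathcal U$-interpretable when the atomic formulas $\mathcal I_\sigma(x)$ are interpreted by the clauses of $\mathcal I^{\mathrm{cp}}$ (that is, $x=n$ at type $\mathbb N$, $i=j$ at type $\mathbb B$, and the stated canonical clause for $\langle\mathcal I_{\rho\to\sigma}(h)\rangle^{\boldsymbol f,\boldsymbol g}_{\boldsymbol a,\boldsymbol d}$ at function types) and $x\equiv_\sigma y$ is interpreted as $x=y$. -}

module Defs where

open import Data.Bool.Base using (Bool; true; false; if_then_else_)
open import Data.List.Base as List using (List; []; _∷_; _++_; foldr)
open import Data.List.Extrema.Nat using (max; max≤v⁺; xs≤max; ⊥≤max)
open import Data.List.Membership.Propositional using (_∈_)
open import Data.List.Membership.Propositional.Properties using (∈-++⁺ˡ; ∈-++⁺ʳ)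
import Data.List.Membership.Setoid as SetoidMembership
import Data.List.Membership.Setoid.Properties as SetoidMembershipₚ
import Data.List.Relation.Binary.Subset.Setoid as SetoidSubset
open import Data.List.NonEmpty.Base as List⁺ using (List⁺; _∷_; toList; _⁺++⁺_; concatMap)
open import Data.List.Relation.Unary.All as All using (All; []; _∷_)
open import Data.List.Relation.Unary.All.Properties using (++⁻)
open import Data.List.Relation.Unary.Any as Any using (Any; here; there)
import Data.List.Relation.Unary.Any.Properties as Anyₚ
open import Data.Nat.Base using (ℕ; zero; suc; _≤_)
open import Data.Nat.Properties using (≤-antisym)
open import Data.Product.Base using (Σ-syntax; _×_; _,_; proj₁; proj₂; swap)
open import Data.Sum.Base using (inj₁; inj₂)
open import Data.Empty using (⊥)
open import Function.Base using (_∘_; id)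
open import Function.Bundles using (Func; _⟨$⟩_)
open import Function.Relation.Binary.Setoid.Equality using (_⇨_)
open import Level using (0ℓ)
open import Relation.Binary.Bundles using (Setoid)
open import Relation.Binary.PropositionalEquality as ≡ using (_≡_; refl; cong)

-- `plain` is the type system of HA^ω, `starred` the one of the target
-- theory; only the latter has the constructor σ ↦ σ *.

data Kind : Set where
  plain starred : Kind

infixr 20 _⇒_
infix  30 _*

data Ty : Kind → Set where
  N B : ∀ {k} → Ty k
  _⇒_ : ∀ {k} → Ty k → Ty k → Ty k
  _*  : Ty starred → Ty starred

-- Contexts have the most recently bound variable at the head.

Ctx : Kind → Set
Ctx k = List (Ty k)

data Const : ∀ {k} → Ty k → Set where
  K    : ∀ {k} {ρ σ : Ty k} → Const (ρ ⇒ σ ⇒ ρ)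
  S    : ∀ {k} {ρ σ τ : Ty k} → Const ((ρ ⇒ σ ⇒ τ) ⇒ (ρ ⇒ σ) ⇒ ρ ⇒ τ)
  O    : ∀ {k} → Const {k} N
  sc   : ∀ {k} → Const {k} (N ⇒ N)
  rec  : ∀ {k} {σ : Ty k} → Const (σ ⇒ (N ⇒ σ ⇒ σ) ⇒ N ⇒ σ)
  tt ff : ∀ {k} → Const {k} B
  cond : ∀ {k} {σ : Ty k} → Const (B ⇒ σ ⇒ σ ⇒ σ)
  sing : ∀ {σ} → Const (σ ⇒ σ *)
  cup  : ∀ {σ} → Const (σ * ⇒ σ * ⇒ σ *)
  Cup  : ∀ {σ τ} → Const (σ * ⇒ (σ ⇒ τ *) ⇒ τ *)
  m    : Const (N * ⇒ N)

infixl 25 _·_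

data Tm {k} (Γ : Ctx k) : Ty k → Set where
  var : ∀ {σ} → σ ∈ Γ → Tm Γ σ
  con : ∀ {σ} → Const σ → Tm Γ σ
  _·_ : ∀ {σ τ} → Tm Γ (σ ⇒ τ) → Tm Γ σ → Tm Γ τ

Ren : ∀ {k} → Ctx k → Ctx k → Set
Ren Γ Δ = ∀ {σ} → σ ∈ Γ → σ ∈ Δ

ren : ∀ {k} {Γ Δ : Ctx k} {σ} → Ren Γ Δ → Tm Γ σ → Tm Δ σ
ren r (var x) = var (r x)
ren r (con c) = con c
ren r (t · u) = ren r t · ren r u

⌈_⌉ : Ty plain → Ty starred
⌈ N ⌉     = N
⌈ B ⌉     = B
⌈ σ ⇒ τ ⌉ = ⌈ σ ⌉ ⇒ ⌈ τ ⌉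

⌈_⌉ᶜ : ∀ {σ} → Const σ → Const ⌈ σ ⌉
⌈ K ⌉ᶜ    = K
⌈ S ⌉ᶜ    = S
⌈ O ⌉ᶜ    = O
⌈ sc ⌉ᶜ   = sc
⌈ rec ⌉ᶜ  = rec
⌈ tt ⌉ᶜ   = tt
⌈ ff ⌉ᶜ   = ff
⌈ cond ⌉ᶜ = cond

Sub : Ctx plain → Ctx starred → Set
Sub Γ Δ = ∀ {σ} → σ ∈ Γ → Tm Δ ⌈ σ ⌉

⌈_⌉ᵗ : ∀ {Γ Δ σ} → Tm Γ σ → Sub Γ Δ → Tm Δ ⌈ σ ⌉
⌈ var x ⌉ᵗ s = s x
⌈ con c ⌉ᵗ s = con ⌈ c ⌉ᶜ
⌈ t · u ⌉ᵗ s = ⌈ t ⌉ᵗ s · ⌈ u ⌉ᵗ s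

extend : ∀ {Γ Δ σ} → Sub Γ Δ → Sub (σ ∷ Γ) (⌈ σ ⌉ ∷ Δ)
extend s (here refl) = var (here refl)
extend s (there x)   = ren there (s x)

data Lang : Set where
  HA LI Target : Lang

kind : Lang → Kind
kind HA     = plain
kind LI     = plain
kind Target = starred

infix  15 _≐_ _ε_
infixr 12 _∧_
infixr 11 _⟶_

-- Membership is an atomic formula `t ε B`: it is what the bounded
-- quantifiers ∀ b ∈ B abbreviate.  It is not a B-valued function that
-- terms may call, so there are no witnessing terms deciding membership.

data Form : (L : Lang) → Ctx (kind L) → Set where
  _≐_ : ∀ {L} {Γ : Ctx (kind L)} {σ} → Tm Γ σ → Tm Γ σ → Form L Γ
  𝓘   : ∀ {Γ : Ctx plain} {σ} → Tm Γ σ → Form LI Γ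
  _ε_ : ∀ {Γ : Ctx starred} {σ} → Tm Γ σ → Tm Γ (σ *) → Form Target Γ
  bot : ∀ {L} {Γ : Ctx (kind L)} → Form L Γ
  _∧_ _⟶_ : ∀ {L} {Γ : Ctx (kind L)} → Form L Γ → Form L Γ → Form L Γ
  all ex  : ∀ {L} {Γ : Ctx (kind L)} σ → Form L (σ ∷ Γ) → Form L Γ

infix 40 _ᴵ

_ᴵ : ∀ {Γ} → Form HA Γ → Form LI Γ
(t ≐ u) ᴵ = t ≐ u
bot ᴵ     = bot
(A ∧ C) ᴵ = A ᴵ ∧ C ᴵ
(A ⟶ C) ᴵ = A ᴵ ⟶ C ᴵ
all σ A ᴵ = all σ (𝓘 (var (here refl)) ⟶ A ᴵ)
ex σ A ᴵ  = ex σ (𝓘 (var (here refl)) ∧ A ᴵ)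

Tms : Ctx starred → List (Ty starred) → Set
Tms Δ τs = All (Tm Δ) τs

rens : ∀ {Δ Θ τs} → Ren Δ Θ → Tms Δ τs → Tms Θ τs
rens r = All.map (ren r)

infixr 20 _⇛_

_⇛_ : List (Ty starred) → Ty starred → Ty starred
as ⇛ τ = foldr _⇒_ τ as

apply : ∀ {Δ as τ} → Tm Δ (as ⇛ τ) → Tms Δ as → Tm Δ τ
apply f []       = f
apply f (a ∷ as) = apply (f · a) as

applyAll : ∀ {Δ as} cs → Tms Δ (List.map (as ⇛_) cs) → Tms Δ as → Tms Δ cs
applyAll []       []       a = []
applyAll (τ ∷ cs) (f ∷ fs) a = apply f a ∷ applyAll cs fs a

applyAll* : ∀ {Δ as ds} bs → Tms Δ (List.map (λ τ → as ⇛ ds ⇛ τ *) bs) →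
            Tms Δ as → Tms Δ ds → Tms Δ (List.map _* bs)
applyAll* []       []       a d = []
applyAll* (τ ∷ bs) (g ∷ gs) a d = apply (apply g a) d ∷ applyAll* bs gs a d

variables : ∀ {Δ τs} → Ren τs Δ → Tms Δ τs
variables r = All.tabulate (λ x → var (r x))

-- ∀ 𝒃 ∈ 𝑩 A, with the variables 𝒃 of types τs free in A.

allIn : ∀ {Δ} τs → Tms Δ (List.map _* τs) → Form Target (τs ++ Δ) → Form Target Δ
allIn []       []       A = A
allIn (τ ∷ τs) (b ∷ bs) A =
  allIn τs bs (all τ (var (here refl) ε ren (there ∘ ∈-++⁺ʳ τs) b ⟶ A))

-- Types of 𝒇, 𝒈 in ⟨ A → B ⟩, where as, bs are the superscript and
-- subscript types of A, and cs, ds those of B.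

W→ : (as bs cs ds : List (Ty starred)) → List (Ty starred)
W→ as bs cs ds = List.map (as ⇛_) cs ++ List.map (λ τ → as ⇛ ds ⇛ τ *) bs

-- The clause shared by ⟨ A → B ⟩ and by the predicate at function types.
-- The first argument is the interpretation of A in extensions of Δ, the
-- bound variables 𝒃 living in bs ++ Δ.

clause→ : ∀ {Δ} as bs cs ds →
          (∀ {Θ} → Ren Δ Θ → Tms Θ as → Tms Θ bs → Form Target Θ) →
          (Tms Δ cs → Tms Δ ds → Form Target Δ) →
          Tms Δ (W→ as bs cs ds) → Tms Δ (as ++ ds) → Form Target Δ
clause→ as bs cs ds A D fg ad =
  let f , g = ++⁻ (List.map (as ⇛_) cs) fg
      a , d = ++⁻ as ad
  in allIn bs (applyAll* bs g a d)
       (A (∈-++⁺ʳ bs) (rens (∈-++⁺ʳ bs) a) (variables ∈-++⁺ˡ))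
     ⟶ D (applyAll cs f a) d

-- W𝓘, C𝓘 (and W, C below) are the types of the superscript and of the
-- subscript of the interpretation.

W𝓘 C𝓘 : Ty plain → List (Ty starred)
W𝓘 N       = N ∷ []
W𝓘 B       = B ∷ []
W𝓘 (ρ ⇒ σ) = W→ (W𝓘 ρ) (C𝓘 ρ) (W𝓘 σ) (C𝓘 σ)
C𝓘 N       = []
C𝓘 B       = []
C𝓘 (ρ ⇒ σ) = W𝓘 ρ ++ C𝓘 σ

⟨𝓘⟩ : ∀ {Δ} σ → Tm Δ ⌈ σ ⌉ → Tms Δ (W𝓘 σ) → Tms Δ (C𝓘 σ) → Form Target Δ
⟨𝓘⟩ N       x (n ∷ []) [] = x ≐ n
⟨𝓘⟩ B       x (i ∷ []) [] = x ≐ i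
⟨𝓘⟩ (ρ ⇒ σ) h fg       ad = all ⌈ ρ ⌉
  (clause→ (W𝓘 ρ) (C𝓘 ρ) (W𝓘 σ) (C𝓘 σ)
    (λ r → ⟨𝓘⟩ ρ (ren r x))
    (⟨𝓘⟩ σ (ren there h · x))
    (rens there fg) (rens there ad))
  where
  x = var (here refl)

W C : ∀ {Γ} → Form LI Γ → List (Ty starred)
W (t ≐ u)       = []
W (𝓘 {σ = σ} t) = W𝓘 σ
W bot           = []
W (A ∧ D)       = W A ++ W D
W (A ⟶ D)       = W→ (W A) (C A) (W D) (C D)
W (all σ A)     = W A
W (ex σ A)      = W A
C (t ≐ u)       = []
C (𝓘 {σ = σ} t) = C𝓘 σ
C bot           = []
C (A ∧ D)       = C A ++ C D
C (A ⟶ D)       = W A ++ C D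
C (all σ A)     = C A
C (ex σ A)      = List.map _* (C A)

-- ⟨ A ⟩ s a b is ⟨ A ⟩ with superscript a and subscript b, the free
-- variables of A being replaced according to s.

⟨_⟩ : ∀ {Γ Δ} (A : Form LI Γ) → Sub Γ Δ → Tms Δ (W A) → Tms Δ (C A) → Form Target Δ
⟨ t ≐ u ⟩         s a b = ⌈ t ⌉ᵗ s ≐ ⌈ u ⌉ᵗ s
⟨ 𝓘 {σ = σ} t ⟩   s a b = ⟨𝓘⟩ σ (⌈ t ⌉ᵗ s) a b
⟨ bot ⟩           s a b = bot
⟨ A ∧ D ⟩         s a b = ⟨ A ⟩ s (proj₁ (++⁻ (W A) a)) (proj₁ (++⁻ (C A) b))
                        ∧ ⟨ D ⟩ s (proj₂ (++⁻ (W A) a)) (proj₂ (++⁻ (C A) b))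
⟨ A ⟶ D ⟩         s a b = clause→ (W A) (C A) (W D) (C D)
                            (λ r → ⟨ A ⟩ (λ x → ren r (s x))) (⟨ D ⟩ s) a b
⟨ all σ A ⟩       s a b = all ⌈ σ ⌉ (⟨ A ⟩ (extend s) (rens there a) (rens there b))
⟨ ex σ A ⟩        s a b = ex ⌈ σ ⌉
  (allIn (C A) (rens there b)
    (⟨ A ⟩ (λ x → ren (∈-++⁺ʳ (C A)) (extend s x))
           (rens (∈-++⁺ʳ (C A)) (rens there a)) (variables ∈-++⁺ˡ)))

-- The structure S^ω_*, in Bishop style.  Since functions are extensional
-- and finite sets are determined by their elements, each type denotes a
-- setoid: elements of σ ⇒ τ are all functions that respect equality,
-- compared pointwise, and elements of σ * are non-empty lists, compared
-- by mutual inclusion.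

module _ (X : Setoid 0ℓ 0ℓ) where
  open Setoid X using (Carrier)
  open SetoidSubset X using (_⊆_)

  FinSet : Setoid 0ℓ 0ℓ
  FinSet = record
    { Carrier       = List⁺ Carrier
    ; _≈_           = λ s t → toList s ⊆ toList t × toList t ⊆ toList s
    ; isEquivalence = record
      { refl  = id , id
      ; sym   = swap
      ; trans = λ (p , q) (p′ , q′) → (λ x → p′ (p x)) , (λ x → q (q′ x))
      }
    }

𝓢 : Ty starred → Setoid 0ℓ 0ℓ
𝓢 N       = ≡.setoid ℕ
𝓢 B       = ≡.setoid Bool
𝓢 (σ ⇒ τ) = 𝓢 σ ⇨ 𝓢 τ
𝓢 (σ *)   = FinSet (𝓢 σ)

El : Ty starred → Set
El σ = Setoid.Carrier (𝓢 σ)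

module _ {X : Setoid 0ℓ 0ℓ} where
  open Setoid X renaming (Carrier to |X|)
  open SetoidMembership X using () renaming (_∈_ to _∈ₓ_)
  open SetoidSubset X using (_⊆_)

  singletonF : Func X (FinSet X)
  singletonF = record
    { to   = List⁺.[_]
    ; cong = λ p → (λ { (here q) → here (trans q p) })
                 , (λ { (here q) → here (trans q (sym p)) })
    }

  ++-mono : ∀ {s s′ t t′ : List |X|} → s ⊆ s′ → t ⊆ t′ → s ++ t ⊆ s′ ++ t′
  ++-mono {s} {s′} p q x with SetoidMembershipₚ.∈-++⁻ X s x
  ... | inj₁ y = SetoidMembershipₚ.∈-++⁺ˡ X (p y)
  ... | inj₂ y = SetoidMembershipₚ.∈-++⁺ʳ X s′ (q y)

  unionF : Func (FinSet X) (FinSet X ⇨ FinSet X)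
  unionF = record
    { to   = λ s → record
      { to   = s ⁺++⁺_
      ; cong = λ (p , q) → ++-mono {toList s} id p , ++-mono {toList s} id q
      }
    ; cong = λ (p , q) t → ++-mono p (id {A = _ ∈ₓ toList t})
                         , ++-mono q (id {A = _ ∈ₓ toList t})
    }

  conditionalF : Func (≡.setoid Bool) (X ⇨ X ⇨ X)
  conditionalF = record
    { to   = λ b → record
      { to   = λ x → record
        { to   = λ y → if b then x else y
        ; cong = λ {y} {y′} p → elseCong b p
        }
      ; cong = λ p y → thenCong b p
      }
    ; cong = λ { refl x y → Setoid.refl X }
    }
    where
    elseCong : ∀ b {x y y′} → y ≈ y′ → (if b then x else y) ≈ (if b then x else y′)
    elseCong true  p = Setoid.refl X
    elseCong false p = p
    thenCong : ∀ b {x x′ y} → x ≈ x′ → (if b then x else y) ≈ (if b then x′ else y)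
    thenCong true  p = p
    thenCong false p = Setoid.refl X

  primRec : |X| → Func (≡.setoid ℕ) (X ⇨ X) → ℕ → |X|
  primRec x f zero    = x
  primRec x f (suc n) = (f ⟨$⟩ n) ⟨$⟩ primRec x f n

  recursorF : Func X ((≡.setoid ℕ ⇨ X ⇨ X) ⇨ ≡.setoid ℕ ⇨ X)
  recursorF = record
    { to   = λ x → record
      { to   = λ f → record
        { to   = primRec x f
        ; cong = λ { refl → Setoid.refl X }
        }
      ; cong = λ {f} {g} p n → stepCong x f g p n
      }
    ; cong = λ p f n → baseCong p f n
    }
    where
    stepCong : ∀ x (f g : Func (≡.setoid ℕ) (X ⇨ X)) →
               (∀ n y → (f ⟨$⟩ n) ⟨$⟩ y ≈ (g ⟨$⟩ n) ⟨$⟩ y) →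
               ∀ n → primRec x f n ≈ primRec x g n
    stepCong x f g p zero    = Setoid.refl X
    stepCong x f g p (suc n) =
      trans (p n (primRec x f n)) (Func.cong (g ⟨$⟩ n) (stepCong x f g p n))
    baseCong : ∀ {x y} → x ≈ y → ∀ f n → primRec x f n ≈ primRec y f n
    baseCong p f zero    = p
    baseCong p f (suc n) = Func.cong (f ⟨$⟩ n) (baseCong p f n)

module _ {X Y : Setoid 0ℓ 0ℓ} where
  private
    module X = Setoid X
    module Y = Setoid Y
  open SetoidMembership X using (find) renaming (_∈_ to _∈ₓ_)
  open SetoidMembership Y using () renaming (_∈_ to _∈ᵧ_)
  open SetoidMembershipₚ using (∈-concat⁺; ∈-concat⁻)

  constantF : Func X (Y ⇨ X)
  constantF = record
    { to   = λ x → record { to = λ _ → x ; cong = λ _ → X.refl }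
    ; cong = λ p _ → p
    }

  private
    ∈-⋃⁺ : ∀ (s : List⁺ X.Carrier) (f : X.Carrier → List⁺ Y.Carrier) {y} →
           Any (λ x → y ∈ᵧ toList (f x)) (toList s) → y ∈ᵧ toList (concatMap f s)
    ∈-⋃⁺ (x ∷ xs) f p = ∈-concat⁺ Y {xss = List.map toList (List.map f (x ∷ xs))}
        (Anyₚ.map⁺ (Anyₚ.map⁺ p))

    ∈-⋃⁻ : ∀ (s : List⁺ X.Carrier) (f : X.Carrier → List⁺ Y.Carrier) {y} →
           y ∈ᵧ toList (concatMap f s) → Any (λ x → y ∈ᵧ toList (f x)) (toList s)
    ∈-⋃⁻ (x ∷ xs) f p =
      Anyₚ.map⁻ (Anyₚ.map⁻ (∈-concat⁻ Y (List.map toList (List.map f (x ∷ xs))) p))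

    ⋃-mono : ∀ (s t : List⁺ X.Carrier) (f g : Func X (FinSet Y)) →
             (∀ {x} → x ∈ₓ toList s → x ∈ₓ toList t) →
             (∀ x {y} → y ∈ᵧ toList (f ⟨$⟩ x) → y ∈ᵧ toList (g ⟨$⟩ x)) →
             ∀ {y} → y ∈ᵧ toList (concatMap (f ⟨$⟩_) s) →
             y ∈ᵧ toList (concatMap (g ⟨$⟩_) t)
    ⋃-mono s t f g p q y∈ =
      let x , x∈s , y∈fx = find (∈-⋃⁻ s (f ⟨$⟩_) y∈)
      in ∈-⋃⁺ t (g ⟨$⟩_)
           (Any.map (λ x≈x′ → proj₁ (Func.cong g x≈x′) (q x y∈fx)) (p x∈s))

  indexedUnionF : Func (FinSet X) ((X ⇨ FinSet Y) ⇨ FinSet Y)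
  indexedUnionF = record
    { to   = λ s → record
      { to   = λ f → concatMap (f ⟨$⟩_) s
      ; cong = λ {f} {g} p → ⋃-mono s s f g id (λ x → proj₁ (p x))
                           , ⋃-mono s s g f id (λ x → proj₂ (p x))
      }
    ; cong = λ {s} {t} (p , q) f → ⋃-mono s t f f p (λ _ → id)
                                 , ⋃-mono t s f f q (λ _ → id)
    }

module _ {X Y Z : Setoid 0ℓ 0ℓ} where
  private module Z = Setoid Z

  substitutionF : Func (X ⇨ Y ⇨ Z) ((X ⇨ Y) ⇨ X ⇨ Z)
  substitutionF = record
    { to   = λ f → record
      { to   = λ g → record
        { to   = λ x → (f ⟨$⟩ x) ⟨$⟩ (g ⟨$⟩ x)
        ; cong = λ {x} {x′} p →
            Z.trans (Func.cong f p (g ⟨$⟩ x)) (Func.cong (f ⟨$⟩ x′) (Func.cong g p))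
        }
      ; cong = λ p x → Func.cong (f ⟨$⟩ x) (p x)
      }
    ; cong = λ p g x → p x (g ⟨$⟩ x)
    }

maximum : List⁺ ℕ → ℕ
maximum (n ∷ ns) = max n ns

maximumF : Func (FinSet (≡.setoid ℕ)) (≡.setoid ℕ)
maximumF = record
  { to   = maximum
  ; cong = λ {s} {t} (p , q) → ≤-antisym (mono s t p) (mono t s q)
  }
  where
  upper : ∀ s → All (_≤ maximum s) (toList s)
  upper (n ∷ ns) = ⊥≤max n ns ∷ xs≤max n ns

  mono : ∀ s t → (∀ {n} → n ∈ toList s → n ∈ toList t) → maximum s ≤ maximum t
  mono s@(_ ∷ _) t p with All.tabulate {xs = toList s} (λ x → All.lookup (upper t) (p x))
  ... | q ∷ qs = max≤v⁺ q qs

⟦_⟧ᶜ : ∀ {σ} → Const σ → El σ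
⟦ K {ρ = ρ} {σ} ⟧ᶜ       = constantF {𝓢 ρ} {𝓢 σ}
⟦ S {ρ = ρ} {σ} {τ} ⟧ᶜ   = substitutionF {𝓢 ρ} {𝓢 σ} {𝓢 τ}
⟦ O ⟧ᶜ                   = zero
⟦ sc ⟧ᶜ                  = record { to = suc ; cong = cong suc }
⟦ rec {σ = σ} ⟧ᶜ         = recursorF {𝓢 σ}
⟦ tt ⟧ᶜ                  = true
⟦ ff ⟧ᶜ                  = false
⟦ cond {σ = σ} ⟧ᶜ        = conditionalF {𝓢 σ}
⟦ sing {σ} ⟧ᶜ            = singletonF {𝓢 σ}
⟦ cup {σ} ⟧ᶜ             = unionF {𝓢 σ}
⟦ Cup {σ} {τ} ⟧ᶜ         = indexedUnionF {𝓢 σ} {𝓢 τ}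
⟦ m ⟧ᶜ                   = maximumF

Env : Ctx starred → Set
Env Δ = All El Δ

⟦_⟧ : ∀ {Δ σ} → Tm Δ σ → Env Δ → El σ
⟦ var x ⟧ η = All.lookup η x
⟦ con c ⟧ η = ⟦ c ⟧ᶜ
⟦ t · u ⟧ η = ⟦ t ⟧ η ⟨$⟩ ⟦ u ⟧ η

infix 4 _⊨_

_⊨_ : ∀ {Δ} → Env Δ → Form Target Δ → Set
η ⊨ _≐_ {σ = σ} t u = Setoid._≈_ (𝓢 σ) (⟦ t ⟧ η) (⟦ u ⟧ η)
η ⊨ _ε_ {σ = σ} t u = SetoidMembership._∈_ (𝓢 σ) (⟦ t ⟧ η) (toList (⟦ u ⟧ η))
η ⊨ bot             = ⊥
η ⊨ A ∧ D           = (η ⊨ A) × (η ⊨ D)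
η ⊨ A ⟶ D           = η ⊨ A → η ⊨ D
η ⊨ all σ A         = ∀ (x : El σ) → x ∷ η ⊨ A
η ⊨ ex σ A          = Σ[ x ∈ El σ ] (x ∷ η ⊨ A)

-- The target theory is the set of sentences true in S^ω_*.

T⊢_ : Form Target [] → Set
T⊢ A = [] ⊨ A

closure : ∀ Δ → Form Target Δ → Form Target []
closure []      A = A
closure (τ ∷ Δ) A = closure Δ (all τ A)

U-interpretable : Form LI [] → Set
U-interpretable A =
  Σ[ t ∈ Tms [] (W A) ] T⊢ closure (C A) (⟨ A ⟩ (λ ()) (rens (λ ()) t) (variables id))

Icp-interpretable : Form HA [] → Set
Icp-interpretable A = U-interpretable (A ᴵ)

module _ {Γ : Ctx plain} where

  pred : Tm Γ (N ⇒ N)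
  pred = con rec · con O · con K

  -- Truncated subtraction, by recursion on y.
  _∸̇_ : Tm Γ N → Tm Γ N → Tm Γ N
  x ∸̇ y = con rec · x · (con K · pred) · y

  _≤̇_ : Tm Γ N → Tm Γ N → Form HA Γ
  x ≤̇ y = (x ∸̇ y) ≐ con O

-- de Bruijn variables.  In the sentence below, from the head of the
-- context: n, g, N, f, Φ in the premise and g, N, f, Φ in the conclusion.

pattern v₀ = var (here refl)
pattern v₁ = var (there (here refl))
pattern v₂ = var (there (there (here refl)))
pattern v₃ = var (there (there (there (here refl))))

pointwiseContinuity : Form HA []
pointwiseContinuity =
  all ((N ⇒ N) ⇒ N) (all (N ⇒ N) (ex N (all (N ⇒ N)
    ( all N (v₀ ≤̇ v₂ ⟶ v₃ · v₀ ≐ v₁ · v₀)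
    ⟶ v₃ · v₂ ≐ v₃ · v₀))))

{-# OPTIONS --safe #-}
module Submission where

open import Defs
open import Data.List.Base using ([]; _∷_)
open import Data.List.Extrema.Nat using (xs≤max; ⊥≤max)
open import Data.List.Membership.Propositional using (_∈_)
open import Data.List.NonEmpty.Base using (List⁺; _∷_; toList)
open import Data.List.Relation.Unary.All as All using (All; []; _∷_)
open import Data.List.Relation.Unary.Any using (here)
open import Data.Nat.Base as ℕ using (ℕ; zero; suc; _∸_; _≤_)
open import Data.Nat.Properties using (pred[m∸n]≡m∸[1+n]; m≤n⇒m∸n≡0)
open import Data.Product.Base using (_,_)
open import Function.Bundles using (_⟨$⟩_)
open import Relation.Binary.PropositionalEquality

-- Given a value functional Ψ and a modulus μ for Φ, and α canonical for f, take
-- max (μ α) for N.  If g agrees with f up to N, then both agree with α on μ α, so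
-- Φ f = Ψ α = Φ g.  Hence the canonicity of Φ is used at α only, and that of f,
-- as well as f n = g n, at the elements of μ α only.

∈⇒≤maximum : ∀ (s : List⁺ ℕ) {n} → n ∈ toList s → n ≤ maximum s
∈⇒≤maximum (n ∷ ns) = All.lookup (⊥≤max n ns ∷ xs≤max n ns)

-- The step function of the recursion that interprets x ∸̇ y.
predecessor : El (N ⇒ N ⇒ N)
predecessor = ⟦ ⌈_⌉ᵗ {[]} {[]} (con (K {σ = N}) · pred) (λ ()) ⟧ []

-- Makes facts about `∸` available for the coded inequality `x ∸̇ y ≐ con O`.
iteratedPredecessor≡∸ : ∀ a n → primRec a predecessor n ≡ a ∸ n
iteratedPredecessor≡∸ a zero    = refl
iteratedPredecessor≡∸ a (suc n) = begin
  primRec a predecessor (suc n)     ≡⟨ predecessor≡pred n (primRec a predecessor n) ⟩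
  ℕ.pred (primRec a predecessor n)  ≡⟨ cong ℕ.pred (iteratedPredecessor≡∸ a n) ⟩
  ℕ.pred (a ∸ n)                    ≡⟨ pred[m∸n]≡m∸[1+n] a n ⟩
  a ∸ suc n                         ∎
  where
  open ≡-Reasoning
  predecessor≡pred : ∀ n k → (predecessor ⟨$⟩ n) ⟨$⟩ k ≡ ℕ.pred k
  -- Only on a constructor does the recursor inside `pred` reduce.
  predecessor≡pred n zero    = refl
  predecessor≡pred n (suc k) = refl

-- AgreeOn and AgreeUpTo have the shape of ⟨ ∀n (I(n) → …) ⟩ bounded by ∀ k ∈ s,
-- and n ≤ b is n ∸̇ b ≐ 0.
AgreeOn : El (N *) → El (N ⇒ N) → El (N ⇒ N) → Set
AgreeOn s f g = ∀ k → k ∈ toList s → ∀ n → n ≡ k → f ⟨$⟩ n ≡ g ⟨$⟩ k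

AgreeUpTo : ℕ → El (N *) → El (N ⇒ N) → El (N ⇒ N) → Set
AgreeUpTo b s f g =
  ∀ k → k ∈ toList s → ∀ n → n ≡ k → primRec n predecessor b ≡ 0 → f ⟨$⟩ n ≡ g ⟨$⟩ n

agreeOnModulus⇒≡ :
  ∀ (Φ Ψ : El ((N ⇒ N) ⇒ N)) (μ : El ((N ⇒ N) ⇒ N *)) (α : El (N ⇒ N)) →
  (∀ f → AgreeOn (μ ⟨$⟩ α) f α → Φ ⟨$⟩ f ≡ Ψ ⟨$⟩ α) →
  ∀ f → AgreeOn (μ ⟨$⟩ α) f α →
  ∀ g → AgreeUpTo (maximum (μ ⟨$⟩ α)) (μ ⟨$⟩ α) f g → Φ ⟨$⟩ f ≡ Φ ⟨$⟩ g
agreeOnModulus⇒≡ Φ Ψ μ α Φ≡Ψα f f≡α g f≡g = trans (Φ≡Ψα f f≡α) (sym (Φ≡Ψα g g≡α))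
  where
  g≡α : AgreeOn (μ ⟨$⟩ α) g α
  g≡α k k∈μα .k refl = trans (sym (f≡g k k∈μα k refl k≤N)) (f≡α k k∈μα k refl)
    where
    k≤N = trans (iteratedPredecessor≡∸ k (maximum (μ ⟨$⟩ α)))
                (m≤n⇒m∸n≡0 (∈⇒≤maximum (μ ⟨$⟩ α) k∈μα))

proposition7p6 : Icp-interpretable pointwiseContinuity
proposition7p6 =
  -- Applied to Ψ, μ, α: N; to a further h: the n at which f n = g n is needed, and
  -- the points at which g is tested against h, where any value would do; to a
  -- further H instead of h: the points at which f is tested against α, and the
  -- arguments at which Φ is tested.
  ( con K · (con S · (con K · con m))
  ∷ con K · (con S · (con K · con K))
  ∷ con K · (con S · (con K · con K))
  ∷ con K · (con S · (con K · con K))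
  ∷ con K · (con K · (con S · (con K · con K) · con sing))
  ∷ [])
  -- `closure` binds the last subscript outermost, hence the reversed order. `H` is the finite set
  -- of functions `h` that bounds the clause for the existential quantifier.
  , λ H α μ Ψ Φ Φ-canonical f f-canonical →
      maximum (μ ⟨$⟩ α) , λ h h∈H → refl , λ g g-canonical f≡g →
        -- The last witnessing term yields the singleton of `α`, in which membership means pointwise
        -- equality.
        agreeOnModulus⇒≡ Φ Ψ μ α (Φ-canonical α (here λ _ → refl)) f f-canonical g f≡g
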